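{- Let $q$ be a prime power, $f\in\mathcal{LP}_q$ and $g_1,g_2\in\mathcal{P}_q$. Then $\odot_f(g_1,g_2)\in\mathcal{P}_q$ if and only if the subset $$\{(g_1(a),\,g_2(a),\,\odot_f(g_1,g_2)(a))\colon a\in\mathbb{F}_q\}\subset\mathrm{Ent}(L_f)$$ is a transversal of $L_f$.
   Context: $\mathbb{F}_q$ is the finite field with $q$ elements. $\mathcal{P}_q$ is the set of polynomials in $\mathbb{F}_q[x]$ of degree less than $q$ that act as permutations of $\mathbb{F}_q$. $\mathcal{LP}_q$ is the set of polynomials $f\in\mathbb{F}_q[x,y]$ of degree less than $q$ in each variable such that, for every $a\in\mathbb{F}_q$, both $f(x,a)$ and $f(a,x)$ act as permutations of $\mathbb{F}_q$. For $f\in\mathcal{LP}_q$ and $g_1,g_2\in\mathcal{P}_q$, put $\odot_f(g_1,g_2):=f(g_1(x),g_2(x))\in\mathbb{F}_q[x]$, taken modulo $x^q-x$. $L_f$ is the Latin square with rows, columns and symbols indexed by $\mathbb{F}_q$ given by $L_f[a,b]:=f(a,b)$, and $\mathrm{Ent}(L_f):=\{(a,b,L_f[a,b])\colon a,b\in\mathbb{F}_q\}$. A transversal of $L_f$ is a subset of $\mathrm{Ent}(L_f)$ formed by $q$ entries, no two of which lie in the same row, lie in the same column, or contain the same symbol. -}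

module Defs where

open import Algebra.Apartness.Bundles using (HeytingField)
open import Data.Fin.Base using (Fin)
open import Data.List.Base using (List; []; _∷_; map; take; drop)
open import Data.Nat.Base using (ℕ; zero; suc; _≤_; _^_)
open import Data.Nat.Primality using (Prime)
open import Data.Product.Base using (Σ; ∃; ∃₂; _×_; _,_; proj₁; proj₂)
open import Data.Product.Relation.Binary.Pointwise.NonDependent using (_×ₛ_)
open import Data.Sum.Base using (_⊎_)
open import Function.Bundles using (Bijection)
open import Function.Definitions using (Bijective)
open import Level using (Level; _⊔_)
open import Relation.Binary.Bundles using (Setoid)
import Relation.Binary.Construct.On as On
open import Relation.Binary.PropositionalEquality.Core using (_≡_)
import Relation.Binary.PropositionalEquality.Properties as ≡
open import Relation.Nullary.Negation using (¬_)
open import Relation.Unary using (Pred; _∈_; _⊆_)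

IsPrimePower : ℕ → Set
IsPrimePower q = ∃₂ λ p k → Prime p × 1 ≤ k × q ≡ p ^ k

HasCardinality : ∀ {a ℓ} → Setoid a ℓ → ℕ → Set (a ⊔ ℓ)
HasCardinality S n = Bijection (≡.setoid (Fin n)) S

-- The field 𝔽_q is any F : HeytingField with HasCardinality (setoid F) q.
-- Finiteness makes equality and invertibility decidable, so the apartness of
-- such an F is just inequality and F is a field in the usual sense.
module Over {c ℓ₁ ℓ₂} (F : HeytingField c ℓ₁ ℓ₂) (q : ℕ) where

  open HeytingField F hiding (zero)

  infixl 6 _+ₚ_
  infixl 7 _*ₚ_

  -- Coefficient lists, constant term first; trailing zeros are allowed.
  Poly : Set c
  Poly = List Carrier

  -- 𝔽_q[x][y]: the j-th element of the list is the coefficient, in 𝔽_q[x],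
  -- of y ^ j.
  Poly₂ : Set c
  Poly₂ = List Poly

  coeff : Poly → ℕ → Carrier
  coeff []      _       = 0#
  coeff (a ∷ p) zero    = a
  coeff (a ∷ p) (suc i) = coeff p i

  -- coeff₂ f i j is the coefficient of x ^ i * y ^ j.
  coeff₂ : Poly₂ → ℕ → ℕ → Carrier
  coeff₂ []      _ _       = 0#
  coeff₂ (p ∷ f) i zero    = coeff p i
  coeff₂ (p ∷ f) i (suc j) = coeff₂ f i j

  eval : Poly → Carrier → Carrier
  eval []      a = 0#
  eval (b ∷ p) a = b + a * eval p a

  -- eval₂ f a b is f(a,b).
  eval₂ : Poly₂ → Carrier → Carrier → Carrier
  eval₂ []      a b = 0#
  eval₂ (p ∷ f) a b = eval p a + b * eval₂ f a b

  _+ₚ_ : Poly → Poly → Poly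
  []      +ₚ r       = r
  (a ∷ p) +ₚ []      = a ∷ p
  (a ∷ p) +ₚ (b ∷ r) = (a + b) ∷ (p +ₚ r)

  _*ₚ_ : Poly → Poly → Poly
  []      *ₚ r = []
  (a ∷ p) *ₚ r = map (a *_) r +ₚ (0# ∷ (p *ₚ r))

  -- compose p g is p(g(x)), and compose₂ f g₁ g₂ is f(g₁(x),g₂(x)).
  compose : Poly → Poly → Poly
  compose []      g = []
  compose (a ∷ p) g = (a ∷ []) +ₚ g *ₚ compose p g

  compose₂ : Poly₂ → Poly → Poly → Poly
  compose₂ []      g₁ g₂ = []
  compose₂ (p ∷ f) g₁ g₂ = compose p g₁ +ₚ g₂ *ₚ compose₂ f g₁ g₂

  -- One use of x ^ q ≡ x: writing p = lo + x ^ q * hi with lo of length at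
  -- most q, the result is lo + x * hi.
  fold-x^q : Poly → Poly
  fold-x^q p = take q p +ₚ (0# ∷ drop q p)

  -- The representative of p modulo x ^ q - x of degree less than q (for
  -- q ≥ 2).  By induction the remainder of the tail has length at most q, so
  -- a ∷ (p mod[x^q-x]) has length at most q + 1 and one folding step suffices.
  _mod[x^q-x] : Poly → Poly
  []      mod[x^q-x] = []
  (a ∷ p) mod[x^q-x] = fold-x^q (a ∷ (p mod[x^q-x]))

  ⊙ : Poly₂ → Poly → Poly → Poly
  ⊙ f g₁ g₂ = compose₂ f g₁ g₂ mod[x^q-x]

  IsPermutation : (Carrier → Carrier) → Set (c ⊔ ℓ₁)
  IsPermutation = Bijective _≈_ _≈_

  record 𝓟 (g : Poly) : Set (c ⊔ ℓ₁) where
    field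
      degree<q    : ∀ i → q ≤ i → coeff g i ≈ 0#
      permutation : IsPermutation (eval g)

  record 𝓛𝓟 (f : Poly₂) : Set (c ⊔ ℓ₁) where
    field
      degree<q     : ∀ i j → q ≤ i ⊎ q ≤ j → coeff₂ f i j ≈ 0#
      permutationˣ : ∀ a → IsPermutation (λ x → eval₂ f x a)
      permutationʸ : ∀ a → IsPermutation (λ x → eval₂ f a x)

  record LatinSquare : Set (c ⊔ ℓ₁) where
    field
      _[_,_] : Carrier → Carrier → Carrier
      cong   : ∀ {a a′ b b′} → a ≈ a′ → b ≈ b′ → _[_,_] a b ≈ _[_,_] a′ b′
      rows   : ∀ a → IsPermutation (λ b → _[_,_] a b)
      cols   : ∀ b → IsPermutation (λ a → _[_,_] a b)

  eval-cong : ∀ p {a a′} → a ≈ a′ → eval p a ≈ eval p a′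
  eval-cong []      a≈a′ = refl
  eval-cong (b ∷ p) a≈a′ = +-cong refl (*-cong a≈a′ (eval-cong p a≈a′))

  eval₂-cong : ∀ f {a a′ b b′} → a ≈ a′ → b ≈ b′ → eval₂ f a b ≈ eval₂ f a′ b′
  eval₂-cong []      a≈a′ b≈b′ = refl
  eval₂-cong (p ∷ f) a≈a′ b≈b′ =
    +-cong (eval-cong p a≈a′) (*-cong b≈b′ (eval₂-cong f a≈a′ b≈b′))

  L : (f : Poly₂) → f ∈ 𝓛𝓟 → LatinSquare
  L f f∈𝓛𝓟 = record
    { _[_,_] = eval₂ f
    ; cong   = eval₂-cong f
    ; rows   = 𝓛𝓟.permutationʸ f∈𝓛𝓟
    ; cols   = 𝓛𝓟.permutationˣ f∈𝓛𝓟
    }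

  -- Triples (row , column , symbol).
  entrySetoid : Setoid c ℓ₁
  entrySetoid = setoid ×ₛ (setoid ×ₛ setoid)

  open Setoid entrySetoid public using () renaming (Carrier to Entry; _≈_ to _≈ₑ_)

  row col symbol : Entry → Carrier
  row (r , _ , _) = r
  col (_ , k , _) = k
  symbol (_ , _ , s) = s

  -- The set { h(a) : a ∈ A } of triples.
  range : ∀ {a} {A : Set a} → (A → Entry) → Pred Entry (a ⊔ ℓ₁)
  range h t = ∃ λ a → t ≈ₑ h a

  Ent : LatinSquare → Pred Entry (c ⊔ ℓ₁)
  Ent M = range λ ((a , b) : Carrier × Carrier) → a , b , M [ a , b ]
    where open LatinSquare

  -- Its elements are compared as triples, ignoring the membership proofs.
  subsetSetoid : ∀ {ℓ} → Pred Entry ℓ → Setoid (c ⊔ ℓ) ℓ₁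
  subsetSetoid T = On.setoid {B = Σ Entry T} entrySetoid proj₁

  record IsTransversal {ℓ} (M : LatinSquare) (T : Pred Entry ℓ) : Set (c ⊔ ℓ₁ ⊔ ℓ) where
    field
      T⊆Ent            : T ⊆ Ent M
      q-entries        : HasCardinality (subsetSetoid T) q
      distinct-rows    : ∀ {s t} → s ∈ T → t ∈ T → ¬ s ≈ₑ t → ¬ row s ≈ row t
      distinct-cols    : ∀ {s t} → s ∈ T → t ∈ T → ¬ s ≈ₑ t → ¬ col s ≈ col t
      distinct-symbols : ∀ {s t} → s ∈ T → t ∈ T → ¬ s ≈ₑ t → ¬ symbol s ≈ symbol t

{-# OPTIONS --safe #-}
-- In a finite field a ^ q ≈ a, so reducing modulo x ^ q - x does not change
-- the values of a polynomial: ⊙ f g₁ g₂ takes the value f(g₁(a),g₂(a)) at a.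
-- Since g₁ and g₂ are injective, T always has q entries in distinct rows and
-- distinct columns, and its symbols are distinct exactly when ⊙ f g₁ g₂ is
-- injective, which on a finite set means that it is a permutation.
module Submission where

open import Defs
open import Algebra.Apartness.Bundles using (HeytingField)
open import Algebra.Bundles using (CommutativeRing; Semiring)
import Algebra.Apartness.Properties.HeytingCommutativeRing as HeytingCommutativeRingProperties
import Algebra.Definitions.RawSemiring as RawSemiring
import Algebra.Properties.CommutativeMonoid.Sum as CommutativeMonoidSum
import Algebra.Properties.CommutativeSemigroup as CommutativeSemigroupProperties
open import Data.Fin.Base using (Fin; suc; punchIn; punchOut)
open import Data.Fin.Permutation using (Permutation; _⟨$⟩ʳ_)
open import Data.Fin.Properties using (any?; injective⇒≤; punchInᵢ≢i; punchOut-injective)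
  renaming (_≟_ to _≟ᶠ_)
open import Data.List.Base using ([]; _∷_; length; map; take; drop)
open import Data.List.Properties using (length-take; length-drop)
open import Data.Nat.Base as ℕ using (ℕ; zero; suc; _≤_; z≤n; s≤s)
import Data.Nat.Properties as ℕ
open import Data.Nat.Primality using (prime⇒nonZero; prime⇒nonTrivial)
open import Data.Product.Base using (_×_; _,_; ∃; proj₁; proj₂)
open import Data.Vec.Functional using (replicate)
open import Function.Base using (_∘_)
open import Function.Bundles using (_⇔_; mk⇔; mk⤖; Inverse)
open import Function.Consequences.Propositional using (strictlySurjective⇒surjective)
import Function.Consequences.Setoid as Consequences
open import Function.Definitions using (Bijective; Congruent; Injective; StrictlySurjective)
open import Function.Properties.Bijection using (Bijection⇒Inverse; ⤖⇒↔)
open import Function.Properties.Inverse using (Inverse⇒Injection)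
import Function.Construct.Symmetry as Symmetry
open import Relation.Binary.Bundles using (Setoid)
open import Relation.Binary.Definitions using (Decidable)
open import Relation.Binary.PropositionalEquality as ≡ using (_≡_)
import Relation.Binary.Reasoning.Setoid as SetoidReasoning
open import Relation.Nullary.Decidable using (yes; no; decidable-stable; via-injection)
open import Relation.Nullary.Negation using (¬_; contradiction)
open import Relation.Unary using (_∈_; _⊆_)

-- Size of a prime power; injective self-maps of finite sets.

primePower⇒2≤ : ∀ {q} → IsPrimePower q → 2 ≤ q
primePower⇒2≤ {q} (p , k , p-prime , 1≤k , q≡pᵏ) = begin
  2       ≤⟨ ℕ.nonTrivial⇒n>1 p ⟩
  p       ≡⟨ ℕ.^-identityʳ p ⟨
  p ℕ.^ 1 ≤⟨ ℕ.^-monoʳ-≤ p 1≤k ⟩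
  p ℕ.^ k ≡⟨ q≡pᵏ ⟨
  q       ∎
  where
  open ℕ.≤-Reasoning
  instance
    _ = prime⇒nonZero p-prime
    _ = prime⇒nonTrivial p-prime

-- Pigeonhole principle: if `y` were missed, deleting it from the codomain with `punchOut` would
-- inject a set of `suc n` elements into one of `n` elements.
Fin-injective⇒strictlySurjective : ∀ {n} {f : Fin n → Fin n} →
  Injective _≡_ _≡_ f → StrictlySurjective _≡_ f
Fin-injective⇒strictlySurjective {n = suc n} {f} f-inj y
  with any? (λ i → f i ≟ᶠ y)
... | yes i,fi≡y = i,fi≡y
... | no y∉f     = contradiction (injective⇒≤ f-avoiding-y-injective) ℕ.1+n≰n
  where
  y≢f : ∀ i → ¬ y ≡ f i
  y≢f i y≡fi = y∉f (i , ≡.sym y≡fi)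

  f-avoiding-y-injective : Injective _≡_ _≡_ (λ i → punchOut (y≢f i))
  f-avoiding-y-injective {i} {j} = f-inj ∘ punchOut-injective (y≢f i) (y≢f j)

module Finite {a ℓ} (S : Setoid a ℓ) {n : ℕ} (|S|≡n : HasCardinality S n) where

  open Setoid S

  enumeration : Inverse (≡.setoid (Fin n)) S
  enumeration = Bijection⇒Inverse |S|≡n

  open Inverse enumeration public using (to; from; to-cong; from-cong)
    renaming (strictlyInverseˡ to to-from; strictlyInverseʳ to from-to)

  to-injective : Injective _≡_ _≈_ to
  to-injective {i} {j} eq = ≡.trans (≡.sym (from-to i)) (≡.trans (from-cong eq) (from-to j))

  from-injective : Injective _≈_ _≡_ from
  from-injective {x} {y} eq = trans (sym (to-from x)) (trans (to-cong eq) (to-from y))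

  infix 4 _≟_
  _≟_ : Decidable _≈_
  _≟_ = via-injection (Inverse⇒Injection (Symmetry.inverse enumeration)) _≟ᶠ_

  module _ {f : Carrier → Carrier} (f-cong : Congruent _≈_ _≈_ f)
           (f-inj : Injective _≈_ _≈_ f) where

    private
      f-onIndices : Fin n → Fin n
      f-onIndices = from ∘ f ∘ to

      f-onIndices-injective : Injective _≡_ _≡_ f-onIndices
      f-onIndices-injective = to-injective ∘ f-inj ∘ from-injective

      f-onIndices-strictlySurjective : StrictlySurjective _≡_ f-onIndices
      f-onIndices-strictlySurjective = Fin-injective⇒strictlySurjective f-onIndices-injective

    -- Conjugating `f` by the enumeration gives an injective self-map of the indices, hence a
    -- permutation of them. In this form it can reindex a product over all elements of the setoid.
    injective⇒permutation : ∃ λ (π : Permutation n n) → ∀ i → to (π ⟨$⟩ʳ i) ≈ f (to i)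
    injective⇒permutation =
      ⤖⇒↔ (mk⤖ (f-onIndices-injective ,
                 strictlySurjective⇒surjective f-onIndices-strictlySurjective)) ,
      λ i → to-from (f (to i))

    injective⇒bijective : Bijective _≈_ _≈_ f
    injective⇒bijective =
      f-inj , Consequences.strictlySurjective⇒surjective S S f-cong λ y →
        let i , fi≡y = f-onIndices-strictlySurjective (from y)
        in to i , from-injective fi≡y

module FiniteField {c ℓ₁ ℓ₂} (F : HeytingField c ℓ₁ ℓ₂) (q : ℕ)
  (|F|≡q : HasCardinality (HeytingField.setoid F) q) where

  open Over F q
  open HeytingField F hiding (zero)
  open Finite setoid |F|≡q

  -- Cancellation, finite products and the identity `a ^ q ≈ a`.

  commutativeRing : CommutativeRing c ℓ₁
  commutativeRing = record { isCommutativeRing = isCommutativeRing }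

  open CommutativeRing commutativeRing
    using (semiring; +-commutativeSemigroup;
           *-commutativeSemigroup; *-commutativeMonoid)
  open HeytingCommutativeRingProperties heytingCommutativeRing using (x-0≈x; 1#0)
  open RawSemiring (Semiring.rawSemiring semiring) using (_^_)
  open CommutativeMonoidSum *-commutativeMonoid using ()
    renaming ( sum to ∏; sum-cong-≋ to ∏-cong; sum-remove to ∏-remove
             ; sum-permute to ∏-permute; ∑-distrib-+ to ∏-distrib-*
             ; sum-replicate to ∏-replicate; sum-replicate-zero to ∏-replicate-1 )
  open CommutativeSemigroupProperties +-commutativeSemigroup using ()
    renaming (interchange to +-interchange)
  open CommutativeSemigroupProperties *-commutativeSemigroup using ()
    renaming (x∙yz≈y∙xz to x*yz≈y*xz)
  open SetoidReasoning setoid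

  -- The field axioms invert elements apart from 0, while only `¬ a ≈ 0#` is given. Equality is
  -- decidable, so suppose that `x` and `y` differ: then `a` cannot be apart from 0, as its inverse
  -- would cancel, and tightness forces `a ≈ 0#`.
  *-cancelˡ-nonZero : ∀ {a x y} → ¬ a ≈ 0# → a * x ≈ a * y → x ≈ y
  *-cancelˡ-nonZero {a} {x} {y} a≉0 ax≈ay =
    decidable-stable (x ≟ y) λ x≉y → a≉0 (proj₁ (tight a 0#) (x≉y ∘ cancel))
    where
    cancel : a # 0# → x ≈ y
    -- Apartness of two elements yields an inverse of their difference, here of `a - 0#`, which must
    -- then be simplified to `a`.
    cancel a#0 with a⁻¹ , a⁻¹[a-0]≈1 , _ ← #⇒invertible a#0 = begin
      x                ≈⟨ a⁻¹[a*z]≈z x ⟨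
      a⁻¹ * (a * x)    ≈⟨ *-congˡ ax≈ay ⟩
      a⁻¹ * (a * y)    ≈⟨ a⁻¹[a*z]≈z y ⟩
      y                ∎
      where
      a⁻¹[a*z]≈z : ∀ z → a⁻¹ * (a * z) ≈ z
      a⁻¹[a*z]≈z z = begin
        a⁻¹ * (a * z)         ≈⟨ *-assoc a⁻¹ a z ⟨
        a⁻¹ * a * z           ≈⟨ *-congʳ (*-congˡ (x-0≈x a)) ⟨
        a⁻¹ * (a - 0#) * z    ≈⟨ *-congʳ a⁻¹[a-0]≈1 ⟩
        1# * z                ≈⟨ *-identityˡ z ⟩
        z                     ∎

  *-nonZero : ∀ {a b} → ¬ a ≈ 0# → ¬ b ≈ 0# → ¬ a * b ≈ 0#
  *-nonZero a≉0 b≉0 ab≈0 = b≉0 (*-cancelˡ-nonZero a≉0 (trans ab≈0 (sym (zeroʳ _))))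

  1≉0 : ¬ 1# ≈ 0#
  1≉0 1≈0 = #-irrefl 1≈0 1#0

  ∏-nonZero : ∀ {n} (t : Fin n → Carrier) → (∀ i → ¬ t i ≈ 0#) → ¬ ∏ t ≈ 0#
  ∏-nonZero {zero}  t t≉0 = 1≉0
  ∏-nonZero {suc n} t t≉0 = *-nonZero (t≉0 Fin.zero) (∏-nonZero (t ∘ suc) (t≉0 ∘ suc))

  ∏-single : ∀ {n} (t : Fin n → Carrier) i → (∀ j → ¬ j ≡ i → t j ≈ 1#) → ∏ t ≈ t i
  ∏-single {suc n} t i t≈1 = begin
    ∏ t                           ≈⟨ ∏-remove {i = i} t ⟩
    t i * ∏ (t ∘ punchIn i)       ≈⟨ *-congˡ (∏-cong λ j → t≈1 (punchIn i j) (punchInᵢ≢i i j)) ⟩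
    t i * ∏ (replicate n 1#)      ≈⟨ *-congˡ (∏-replicate-1 n) ⟩
    t i * 1#                      ≈⟨ *-identityʳ (t i) ⟩
    t i                           ∎

  -- Replacing 0 by 1 lets a product over all of F stand for the product of
  -- the nonzero elements.
  0↦1 : Carrier → Carrier
  0↦1 x with x ≟ 0#
  ... | yes _ = 1#
  ... | no  _ = x

  0↦1-nonZero : ∀ x → ¬ 0↦1 x ≈ 0#
  0↦1-nonZero x with x ≟ 0#
  ... | yes _  = 1≉0
  ... | no x≉0 = x≉0

  0↦1-cong : Congruent _≈_ _≈_ 0↦1
  0↦1-cong {x} {y} x≈y with x ≟ 0# | y ≟ 0#
  ... | yes _   | yes _   = refl
  ... | yes x≈0 | no y≉0  = contradiction (trans (sym x≈y) x≈0) y≉0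
  ... | no x≉0  | yes y≈0 = contradiction (trans x≈y y≈0) x≉0
  ... | no _    | no _    = x≈y

  -- The factor a that 0↦1 (a * x) lacks, compared with a * 0↦1 x, at x = 0.
  defect : Carrier → Carrier → Carrier
  defect a x with x ≟ 0#
  ... | yes _ = a
  ... | no  _ = 1#

  defect-zero : ∀ a {x} → x ≈ 0# → defect a x ≈ a
  defect-zero a {x} x≈0 with x ≟ 0#
  ... | yes _  = refl
  ... | no x≉0 = contradiction x≈0 x≉0

  defect-nonZero : ∀ a {x} → ¬ x ≈ 0# → defect a x ≈ 1#
  defect-nonZero a {x} x≉0 with x ≟ 0#
  ... | yes x≈0 = contradiction x≈0 x≉0
  ... | no  _   = refl

  -- At `x ≈ 0#` both sides come to `a`. Elsewhere `a * x` is nonzero too, so `0↦1` fixes both `x`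
  -- and `a * x` and the defect is 1.
  0↦1-* : ∀ {a} → ¬ a ≈ 0# → ∀ x → 0↦1 (a * x) * defect a x ≈ a * 0↦1 x
  0↦1-* {a} a≉0 x with x ≟ 0# | a * x ≟ 0#
  ... | yes _   | yes _    = *-comm 1# a
  ... | yes x≈0 | no ax≉0  = contradiction (trans (*-congˡ x≈0) (zeroʳ a)) ax≉0
  ... | no x≉0  | yes ax≈0 = contradiction ax≈0 (*-nonZero a≉0 x≉0)
  ... | no _    | no _     = *-identityʳ (a * x)

  -- Zero occurs at exactly one index of the enumeration, so exactly one factor is `a` and all
  -- others are 1.
  ∏-defect : ∀ a → ∏ (defect a ∘ to) ≈ a
  ∏-defect a = begin
    ∏ (defect a ∘ to)           ≈⟨ ∏-single _ (from 0#) (λ j j≢ → defect-nonZero a (j≢ ∘ index-of-0 j)) ⟩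
    defect a (to (from 0#))     ≈⟨ defect-zero a (to-from 0#) ⟩
    a                           ∎
    where
    index-of-0 : ∀ j → to j ≈ 0# → j ≡ from 0#
    index-of-0 j toj≈0 = to-injective (trans toj≈0 (sym (to-from 0#)))

  -- Let P be the product of the nonzero elements, written as a product of `q` factors by means of
  -- `0↦1`. Multiplying every factor by `a` gives `a ^ q * P`. Since multiplication by `a` permutes
  -- the field, the same product is P times the total defect `a`. Cancel P, which is nonzero.
  x^q≈x-nonZero : ∀ {a} → ¬ a ≈ 0# → a ^ q ≈ a
  x^q≈x-nonZero {a} a≉0 =
    *-cancelˡ-nonZero (∏-nonZero (0↦1 ∘ to) (0↦1-nonZero ∘ to)) (begin
      ∏ (0↦1 ∘ to) * a ^ q                                ≈⟨ *-comm _ _ ⟩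
      a ^ q * ∏ (0↦1 ∘ to)                                ≈⟨ *-congʳ (∏-replicate q) ⟨
      ∏ (replicate q a) * ∏ (0↦1 ∘ to)                    ≈⟨ ∏-distrib-* (replicate q a) (0↦1 ∘ to) ⟨
      ∏ (λ i → a * 0↦1 (to i))                            ≈⟨ ∏-cong (λ i → 0↦1-* a≉0 (to i)) ⟨
      ∏ (λ i → 0↦1 (a * to i) * defect a (to i))          ≈⟨ ∏-distrib-* (λ i → 0↦1 (a * to i)) (defect a ∘ to) ⟩
      ∏ (λ i → 0↦1 (a * to i)) * ∏ (defect a ∘ to)        ≈⟨ *-cong (∏-cong (λ i → 0↦1-cong (π≈a* i))) (sym (∏-defect a)) ⟨
      ∏ (λ i → 0↦1 (to (π ⟨$⟩ʳ i))) * a                   ≈⟨ *-congʳ (∏-permute (0↦1 ∘ to) π) ⟨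
      ∏ (0↦1 ∘ to) * a                                    ∎)
    where
    a*-permutation = injective⇒permutation {f = a *_} *-congˡ (*-cancelˡ-nonZero a≉0)
    π = proj₁ a*-permutation
    π≈a* = proj₂ a*-permutation

  ^-congˡ : ∀ n {a b} → a ≈ b → a ^ n ≈ b ^ n
  ^-congˡ zero    a≈b = refl
  ^-congˡ (suc n) a≈b = *-cong a≈b (^-congˡ n a≈b)

  x^q≈x : 1 ≤ q → ∀ a → a ^ q ≈ a
  x^q≈x 1≤q a with a ≟ 0#
  ... | no a≉0  = x^q≈x-nonZero a≉0
  -- The zeroth power of 0 is 1, so this case rests on `1 ≤ q`.
  ... | yes a≈0 = trans (^-congˡ q a≈0) (trans (0^n≈0 1≤q) (sym a≈0))
    where
    0^n≈0 : ∀ {n} → 1 ≤ n → 0# ^ n ≈ 0#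
    0^n≈0 (s≤s _) = zeroˡ _

  -- Values of sums, products, compositions and remainders of polynomials.

  eval-+ₚ : ∀ p r a → eval (p +ₚ r) a ≈ eval p a + eval r a
  eval-+ₚ []      r       a = sym (+-identityˡ _)
  eval-+ₚ (b ∷ p) []      a = sym (+-identityʳ _)
  eval-+ₚ (b ∷ p) (d ∷ r) a = begin
    b + d + a * eval (p +ₚ r) a               ≈⟨ +-congˡ (*-congˡ (eval-+ₚ p r a)) ⟩
    b + d + a * (eval p a + eval r a)         ≈⟨ +-congˡ (distribˡ a _ _) ⟩
    b + d + (a * eval p a + a * eval r a)     ≈⟨ +-interchange b d _ _ ⟩
    (b + a * eval p a) + (d + a * eval r a)   ∎

  eval-map-* : ∀ b p a → eval (map (b *_) p) a ≈ b * eval p a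
  eval-map-* b []      a = sym (zeroʳ b)
  eval-map-* b (d ∷ p) a = begin
    b * d + a * eval (map (b *_) p) a   ≈⟨ +-congˡ (*-congˡ (eval-map-* b p a)) ⟩
    b * d + a * (b * eval p a)          ≈⟨ +-congˡ (x*yz≈y*xz a b _) ⟩
    b * d + b * (a * eval p a)          ≈⟨ distribˡ b d _ ⟨
    b * (d + a * eval p a)              ∎

  eval-*ₚ : ∀ p r a → eval (p *ₚ r) a ≈ eval p a * eval r a
  eval-*ₚ []      r a = sym (zeroˡ _)
  eval-*ₚ (b ∷ p) r a = begin
    eval (map (b *_) r +ₚ (0# ∷ p *ₚ r)) a               ≈⟨ eval-+ₚ (map (b *_) r) _ a ⟩
    eval (map (b *_) r) a + (0# + a * eval (p *ₚ r) a)   ≈⟨ +-cong (eval-map-* b r a) (+-identityˡ _) ⟩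
    b * eval r a + a * eval (p *ₚ r) a                   ≈⟨ +-congˡ (*-congˡ (eval-*ₚ p r a)) ⟩
    b * eval r a + a * (eval p a * eval r a)             ≈⟨ +-congˡ (*-assoc a _ _) ⟨
    b * eval r a + a * eval p a * eval r a               ≈⟨ distribʳ _ b _ ⟨
    (b + a * eval p a) * eval r a                        ∎

  eval-compose : ∀ p g a → eval (compose p g) a ≈ eval p (eval g a)
  eval-compose []      g a = refl
  eval-compose (b ∷ p) g a = begin
    eval ((b ∷ []) +ₚ g *ₚ compose p g) a           ≈⟨ eval-+ₚ (b ∷ []) (g *ₚ compose p g) a ⟩
    b + a * 0# + eval (g *ₚ compose p g) a          ≈⟨ +-cong b+a*0≈b (eval-*ₚ g _ a) ⟩
    b + eval g a * eval (compose p g) a             ≈⟨ +-congˡ (*-congˡ (eval-compose p g a)) ⟩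
    b + eval g a * eval p (eval g a)                ∎
    where
    b+a*0≈b : b + a * 0# ≈ b
    b+a*0≈b = trans (+-congˡ (zeroʳ a)) (+-identityʳ b)

  eval-compose₂ : ∀ f g₁ g₂ a → eval (compose₂ f g₁ g₂) a ≈ eval₂ f (eval g₁ a) (eval g₂ a)
  eval-compose₂ []      g₁ g₂ a = refl
  eval-compose₂ (p ∷ f) g₁ g₂ a = begin
    eval (compose p g₁ +ₚ g₂ *ₚ compose₂ f g₁ g₂) a
      ≈⟨ eval-+ₚ (compose p g₁) _ a ⟩
    eval (compose p g₁) a + eval (g₂ *ₚ compose₂ f g₁ g₂) a
      ≈⟨ +-cong (eval-compose p g₁ a) (eval-*ₚ g₂ _ a) ⟩
    eval p (eval g₁ a) + eval g₂ a * eval (compose₂ f g₁ g₂) a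
      ≈⟨ +-congˡ (*-congˡ (eval-compose₂ f g₁ g₂ a)) ⟩
    eval p (eval g₁ a) + eval g₂ a * eval₂ f (eval g₁ a) (eval g₂ a) ∎

  -- With `n` equal to `q`, this exposes the factor `a ^ q` that `fold-x^q` replaces by `a`.
  eval-take-drop : ∀ n p a → eval p a ≈ eval (take n p) a + a ^ n * eval (drop n p) a
  eval-take-drop zero    p       a = sym (trans (+-identityˡ _) (*-identityˡ _))
  eval-take-drop (suc n) []      a = sym (trans (+-identityˡ _) (zeroʳ _))
  eval-take-drop (suc n) (b ∷ p) a = begin
    b + a * eval p a                    ≈⟨ +-congˡ (*-congˡ (eval-take-drop n p a)) ⟩
    b + a * (lo + a ^ n * hi)           ≈⟨ +-congˡ (distribˡ a lo _) ⟩
    b + (a * lo + a * (a ^ n * hi))     ≈⟨ +-assoc b _ _ ⟨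
    b + a * lo + a * (a ^ n * hi)       ≈⟨ +-congˡ (*-assoc a _ hi) ⟨
    b + a * lo + a ^ suc n * hi         ∎
    where
    lo = eval (take n p) a
    hi = eval (drop n p) a

  eval-fold-x^q : 1 ≤ q → ∀ p a → eval (fold-x^q p) a ≈ eval p a
  eval-fold-x^q 1≤q p a = begin
    eval (take q p +ₚ (0# ∷ drop q p)) a                   ≈⟨ eval-+ₚ (take q p) _ a ⟩
    eval (take q p) a + (0# + a * eval (drop q p) a)       ≈⟨ +-congˡ (+-identityˡ _) ⟩
    eval (take q p) a + a * eval (drop q p) a              ≈⟨ +-congˡ (*-congʳ (x^q≈x 1≤q a)) ⟨
    eval (take q p) a + a ^ q * eval (drop q p) a          ≈⟨ eval-take-drop q p a ⟨
    eval p a                                               ∎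

  eval-mod : 1 ≤ q → ∀ p a → eval (p mod[x^q-x]) a ≈ eval p a
  eval-mod 1≤q []      a = refl
  eval-mod 1≤q (b ∷ p) a =
    trans (eval-fold-x^q 1≤q (b ∷ (p mod[x^q-x])) a) (+-congˡ (*-congˡ (eval-mod 1≤q p a)))

  eval-⊙ : 1 ≤ q → ∀ f g₁ g₂ a → eval (⊙ f g₁ g₂) a ≈ eval₂ f (eval g₁ a) (eval g₂ a)
  eval-⊙ 1≤q f g₁ g₂ a =
    trans (eval-mod 1≤q (compose₂ f g₁ g₂) a) (eval-compose₂ f g₁ g₂ a)

  -- Degree of remainders modulo x ^ q - x.

  coeff-beyond-length : ∀ p {i} → length p ≤ i → coeff p i ≈ 0#
  coeff-beyond-length []      _         = refl
  coeff-beyond-length (b ∷ p) (s≤s p≤i) = coeff-beyond-length p p≤i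

  length-+ₚ-≤ : ∀ p r {n} → length p ≤ n → length r ≤ n → length (p +ₚ r) ≤ n
  length-+ₚ-≤ []      r       _         r≤n       = r≤n
  length-+ₚ-≤ (b ∷ p) []      p≤n       _         = p≤n
  length-+ₚ-≤ (b ∷ p) (d ∷ r) (s≤s p≤n) (s≤s r≤n) = s≤s (length-+ₚ-≤ p r p≤n r≤n)

  -- By induction `r` has at most `q + 1` coefficients, so at most one lies beyond the first `q`.
  -- Folding adds it to the coefficient of x, and a list of length 2 stays within the bound because
  -- `2 ≤ q`.
  length-mod-≤ : 2 ≤ q → ∀ p → length (p mod[x^q-x]) ≤ q
  length-mod-≤ 2≤q []      = z≤n
  length-mod-≤ 2≤q (b ∷ p) = length-+ₚ-≤ (take q r) (0# ∷ drop q r) take≤q drop<q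
    where
    r = b ∷ (p mod[x^q-x])

    take≤q : length (take q r) ≤ q
    take≤q = ≡.subst (_≤ q) (≡.sym (length-take q r)) (ℕ.m⊓n≤m q (length r))

    drop≤1 : length (drop q r) ≤ 1
    drop≤1 = ≡.subst (_≤ 1) (≡.sym (length-drop q r))
      (ℕ.m≤n+o⇒m∸n≤o (length r) q
        (≡.subst (length r ≤_) (ℕ.+-comm 1 q) (s≤s (length-mod-≤ 2≤q p))))

    drop<q : suc (length (drop q r)) ≤ q
    drop<q = ℕ.≤-trans (s≤s drop≤1) 2≤q

  mod-degree<q : 2 ≤ q → ∀ p i → q ≤ i → coeff (p mod[x^q-x]) i ≈ 0#
  mod-degree<q 2≤q p i q≤i =
    coeff-beyond-length (p mod[x^q-x]) (ℕ.≤-trans (length-mod-≤ 2≤q p) q≤i)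

  -- Sets of entries parametrised by the field.

  module _ {r k s : Carrier → Carrier} (r-cong : Congruent _≈_ _≈_ r)
           (k-cong : Congruent _≈_ _≈_ k) (s-cong : Congruent _≈_ _≈_ s)
           (r-inj : Injective _≈_ _≈_ r) where

    private
      entry : Carrier → Entry
      entry a = r a , k a , s a

      entry-cong : Congruent _≈_ _≈ₑ_ entry
      entry-cong a≈b = r-cong a≈b , k-cong a≈b , s-cong a≈b

    -- Members are compared as triples, so an injective row coordinate already keeps the `q` listed
    -- entries apart. A member comes with a parameter `a` that produces it, and the index of `a` is
    -- its preimage.
    range-cardinality : HasCardinality (subsetSetoid (range entry)) q
    range-cardinality = record
      { to        = λ i → entry (to i) , to i , Setoid.refl entrySetoid
      ; cong      = λ { ≡.refl → Setoid.refl entrySetoid }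
      ; bijective = to-injective ∘ r-inj ∘ proj₁ ,
          λ { (t , a , t≈) → from a , λ { ≡.refl →
              Setoid.trans entrySetoid (entry-cong (to-from a)) (Setoid.sym entrySetoid t≈) } }
      }

    -- Rows, columns and symbols are treated alike: `v` is the chosen coordinate as a function of
    -- the parameter. If two coordinates agree, injectivity of `v` makes the parameters agree, and
    -- then the whole triples do.
    distinct-coordinates : ∀ {coordinate : Entry → Carrier} {v : Carrier → Carrier} →
      (∀ {t a} → t ≈ₑ entry a → coordinate t ≈ v a) → Injective _≈_ _≈_ v →
      ∀ {t u} → t ∈ range entry → u ∈ range entry →
      ¬ t ≈ₑ u → ¬ coordinate t ≈ coordinate u
    distinct-coordinates coordinate≈v v-inj (a , t≈) (b , u≈) t≉u eq = t≉u
      (Setoid.trans entrySetoid t≈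
        (Setoid.trans entrySetoid (entry-cong a≈b) (Setoid.sym entrySetoid u≈)))
      where
      a≈b : a ≈ b
      a≈b = v-inj (trans (sym (coordinate≈v t≈)) (trans eq (coordinate≈v u≈)))

    -- Different parameters give different triples, since their rows already differ, and so
    -- different symbols. Decidable equality turns this contrapositive into injectivity.
    distinct-symbols⇒injective :
      (∀ {t u} → t ∈ range entry → u ∈ range entry → ¬ t ≈ₑ u → ¬ symbol t ≈ symbol u) →
      Injective _≈_ _≈_ s
    distinct-symbols⇒injective distinct {a} {b} sa≈sb = decidable-stable (a ≟ b) λ a≉b →
      distinct (a , Setoid.refl entrySetoid) (b , Setoid.refl entrySetoid)
        (a≉b ∘ r-inj ∘ proj₁) sa≈sb

  range⊆Ent : ∀ M (g₁ g₂ s : Carrier → Carrier) →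
    (∀ a → s a ≈ LatinSquare._[_,_] M (g₁ a) (g₂ a)) →
    range (λ a → g₁ a , g₂ a , s a) ⊆ Ent M
  range⊆Ent M g₁ g₂ s s≈M (a , row≈ , col≈ , symbol≈) =
    (g₁ a , g₂ a) , row≈ , col≈ , trans symbol≈ (s≈M a)

lemma5p2 : ∀ {c ℓ₁ ℓ₂} (q : ℕ) → IsPrimePower q →
    (F : HeytingField c ℓ₁ ℓ₂) → HasCardinality (HeytingField.setoid F) q →
    let open Over F q in
    (f : Poly₂) (f∈𝓛𝓟 : f ∈ 𝓛𝓟) (g₁ g₂ : Poly) → g₁ ∈ 𝓟 → g₂ ∈ 𝓟 →
    let T = range (λ a → eval g₁ a , eval g₂ a , eval (⊙ f g₁ g₂) a) in
    (T ⊆ Ent (L f f∈𝓛𝓟)) ×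
    (⊙ f g₁ g₂ ∈ 𝓟 ⇔ IsTransversal (L f f∈𝓛𝓟) T)
lemma5p2 q q-primePower F |F|≡q f f∈𝓛𝓟 g₁ g₂ g₁∈𝓟 g₂∈𝓟 =
  T⊆Ent , mk⇔ permutation⇒transversal transversal⇒permutation
  where
  open Over F q
  open FiniteField F q |F|≡q
  open HeytingField F using (_≈_; setoid)
  open Finite setoid |F|≡q using (injective⇒bijective)

  2≤q : 2 ≤ q
  2≤q = primePower⇒2≤ q-primePower

  g₁-injective : Injective _≈_ _≈_ (eval g₁)
  g₁-injective = proj₁ (𝓟.permutation g₁∈𝓟)

  T = range (λ a → eval g₁ a , eval g₂ a , eval (⊙ f g₁ g₂) a)

  T⊆Ent : T ⊆ Ent (L f f∈𝓛𝓟)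
  -- By definition `2 ≤ q` is `1 < q`, which weakens to `1 ≤ q`.
  T⊆Ent = range⊆Ent (L f f∈𝓛𝓟) _ _ _ (eval-⊙ (ℕ.<⇒≤ 2≤q) f g₁ g₂)

  permutation⇒transversal : ⊙ f g₁ g₂ ∈ 𝓟 → IsTransversal (L f f∈𝓛𝓟) T
  permutation⇒transversal ⊙∈𝓟 = record
    { T⊆Ent            = T⊆Ent
    ; q-entries        = range-cardinality g₁-cong g₂-cong ⊙-cong g₁-injective
    ; distinct-rows    = distinct {row} proj₁ g₁-injective
    ; distinct-cols    = distinct {col} (proj₁ ∘ proj₂) (proj₁ (𝓟.permutation g₂∈𝓟))
    ; distinct-symbols = distinct {symbol} (proj₂ ∘ proj₂) (proj₁ (𝓟.permutation ⊙∈𝓟))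
    }
    where
    g₁-cong = eval-cong g₁
    g₂-cong = eval-cong g₂
    ⊙-cong = eval-cong (⊙ f g₁ g₂)
    distinct = λ {coordinate} {v} →
      distinct-coordinates g₁-cong g₂-cong ⊙-cong g₁-injective {coordinate} {v}

  transversal⇒permutation : IsTransversal (L f f∈𝓛𝓟) T → ⊙ f g₁ g₂ ∈ 𝓟
  transversal⇒permutation T-transversal = record
    -- Every remainder satisfies the degree bound; the transversal enters through the permutation
    -- property.
    { degree<q    = mod-degree<q 2≤q (compose₂ f g₁ g₂)
    ; permutation = injective⇒bijective (eval-cong (⊙ f g₁ g₂))
        (distinct-symbols⇒injective (eval-cong g₁) (eval-cong g₂) (eval-cong (⊙ f g₁ g₂))
          g₁-injective (IsTransversal.distinct-symbols T-transversal))
    }
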